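{- $\text{\ss}_i\leq\mathfrak{c}$ and $\text{\ss}_o\leq\mathfrak{c}$. Consequently, $\text{\ss}\leq\mathfrak{c}$ as well.
   Context: $\mathfrak{c}$ is the cardinality of the continuum; $\mathbb{N}=\{1,2,3,\dots\}$. For $A\subseteq\mathbb{N}$, the subseries $\sum_{n\in A}a_n$ is summed in increasing order of the indices; if $A$ is finite it counts as convergent. A series is conditionally convergent if it converges but not absolutely. A series diverges by oscillation if its partial sums neither converge to a real number nor tend to $+\infty$ nor tend to $-\infty$. The subseries number $\text{\ss}$ is the smallest cardinality of a family $\mathcal{A}$ of subsets of $\mathbb{N}$ such that for every conditionally convergent series $\sum_{n\in\mathbb{N}}a_n$ of real numbers there is $A\in\mathcal{A}$ such that $\sum_{n\in A}a_n$ diverges. $\text{\ss}_i$ (respectively $\text{\ss}_o$) is defined in the same way, except that $\sum_{n\in A}a_n$ is required to diverge to $+\infty$ or to $-\infty$ (respectively, to diverge by oscillation). -}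

module Defs where

open import Data.Bool.Base using (Bool; T)
open import Data.Nat.Base as ℕ using (ℕ; zero; suc; _⊔_)
import Data.Nat.Properties as ℕₚ
open import Data.Product.Base using (Σ-syntax; ∃-syntax; _×_; _,_)
open import Data.Rational.Base as ℚ using (ℚ; 0ℚ; ½)
import Data.Rational.Properties as ℚₚ
open import Data.Rational.Solver using (module +-*-Solver)
open import Data.Sum.Base using (_⊎_; inj₁; inj₂)
open import Function.Base using (_∘_)
open import Function.Bundles using (_⇔_; _↔_; _↣_)
open import Relation.Binary.PropositionalEquality
  using (_≡_; refl; sym; trans; cong; subst)
open import Relation.Nullary.Negation.Core using (¬_)

------------------------------------------------------------------------
-- Real numbers

-- Reals are presented by Cauchy sequences of rationals.  Two sequences
-- present the same real when their difference tends to 0; this relation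
-- is not needed below, because everything is phrased through _<_, which
-- is invariant under it.

record ℝ : Set where
  constructor mkℝ
  field
    seq    : ℕ → ℚ
    cauchy : ∀ ε → 0ℚ ℚ.< ε → ∃[ N ] ∀ m n → N ℕ.≤ m → N ℕ.≤ n →
             ℚ.∣ seq m ℚ.- seq n ∣ ℚ.< ε

open ℝ public

private
  0<½*ε : ∀ {ε} → 0ℚ ℚ.< ε → 0ℚ ℚ.< ½ ℚ.* ε
  0<½*ε 0<ε = ℚₚ.*-monoʳ-<-pos ½ 0<ε

  ½*ε+½*ε : ∀ ε → ½ ℚ.* ε ℚ.+ ½ ℚ.* ε ≡ ε
  ½*ε+½*ε ε =
    trans (sym (ℚₚ.*-distribʳ-+ ε ½ ½)) (ℚₚ.*-identityˡ ε)

  +-interchange-- : ∀ a b c d →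
    (a ℚ.+ b) ℚ.- (c ℚ.+ d) ≡ (a ℚ.- c) ℚ.+ (b ℚ.- d)
  +-interchange-- =
    solve 4 (λ a b c d → (a :+ b) :- (c :+ d) := (a :- c) :+ (b :- d)) refl
    where open +-*-Solver

  neg-swap : ∀ a b → ℚ.- a ℚ.- ℚ.- b ≡ ℚ.- (a ℚ.- b)
  neg-swap = solve 2 (λ a b → :- a :- :- b := :- (a :- b)) refl
    where open +-*-Solver

  neg-- : ∀ a b → ℚ.- (a ℚ.- b) ≡ b ℚ.- a
  neg-- = solve 2 (λ a b → :- (a :- b) := b :- a) refl
    where open +-*-Solver

  -+-cancel : ∀ a b → (a ℚ.- b) ℚ.+ b ≡ a
  -+-cancel = solve 2 (λ a b → (a :- b) :+ b := a) refl
    where open +-*-Solver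

  +--cancel : ∀ a b → (a ℚ.+ b) ℚ.- b ≡ a
  +--cancel = solve 2 (λ a b → (a :+ b) :- b := a) refl
    where open +-*-Solver

  ∣-∣-swap : ∀ a b → ℚ.∣ b ℚ.- a ∣ ≡ ℚ.∣ a ℚ.- b ∣
  ∣-∣-swap a b =
    trans (cong ℚ.∣_∣ (sym (neg-- a b))) (ℚₚ.∣-p∣≡∣p∣ (a ℚ.- b))

  ∣a∣-∣b∣≤∣a-b∣ : ∀ a b → ℚ.∣ a ∣ ℚ.- ℚ.∣ b ∣ ℚ.≤ ℚ.∣ a ℚ.- b ∣
  ∣a∣-∣b∣≤∣a-b∣ a b = begin
    ℚ.∣ a ∣ ℚ.- ℚ.∣ b ∣
      ≡⟨ cong (λ x → ℚ.∣ x ∣ ℚ.- ℚ.∣ b ∣) (-+-cancel a b) ⟨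
    ℚ.∣ (a ℚ.- b) ℚ.+ b ∣ ℚ.- ℚ.∣ b ∣
      ≤⟨ ℚₚ.+-monoˡ-≤ (ℚ.- ℚ.∣ b ∣) (ℚₚ.∣p+q∣≤∣p∣+∣q∣ (a ℚ.- b) b) ⟩
    (ℚ.∣ a ℚ.- b ∣ ℚ.+ ℚ.∣ b ∣) ℚ.- ℚ.∣ b ∣
      ≡⟨ +--cancel ℚ.∣ a ℚ.- b ∣ ℚ.∣ b ∣ ⟩
    ℚ.∣ a ℚ.- b ∣ ∎
    where open ℚₚ.≤-Reasoning

  ∣∣a∣-∣b∣∣≤∣a-b∣ : ∀ a b → ℚ.∣ ℚ.∣ a ∣ ℚ.- ℚ.∣ b ∣ ∣ ℚ.≤ ℚ.∣ a ℚ.- b ∣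
  ∣∣a∣-∣b∣∣≤∣a-b∣ a b with ℚₚ.∣p∣≡p∨∣p∣≡-p (ℚ.∣ a ∣ ℚ.- ℚ.∣ b ∣)
  ... | inj₁ eq = subst (ℚ._≤ ℚ.∣ a ℚ.- b ∣) (sym eq) (∣a∣-∣b∣≤∣a-b∣ a b)
  ... | inj₂ eq = begin
    ℚ.∣ ℚ.∣ a ∣ ℚ.- ℚ.∣ b ∣ ∣  ≡⟨ trans eq (neg-- ℚ.∣ a ∣ ℚ.∣ b ∣) ⟩
    ℚ.∣ b ∣ ℚ.- ℚ.∣ a ∣        ≤⟨ ∣a∣-∣b∣≤∣a-b∣ b a ⟩
    ℚ.∣ b ℚ.- a ∣              ≡⟨ ∣-∣-swap a b ⟩
    ℚ.∣ a ℚ.- b ∣              ∎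
    where open ℚₚ.≤-Reasoning

infix  8 -_
infixl 6 _+_ _-_
infix  4 _<_

0ℝ : ℝ
0ℝ = mkℝ (λ _ → 0ℚ) (λ _ 0<ε → 0 , λ _ _ _ _ → 0<ε)

_+_ : ℝ → ℝ → ℝ
x + y = mkℝ (λ n → seq x n ℚ.+ seq y n) bound
  where
  bound : ∀ ε → 0ℚ ℚ.< ε → ∃[ N ] ∀ m n → N ℕ.≤ m → N ℕ.≤ n →
          ℚ.∣ (seq x m ℚ.+ seq y m) ℚ.- (seq x n ℚ.+ seq y n) ∣ ℚ.< ε
  bound ε 0<ε with cauchy x (½ ℚ.* ε) (0<½*ε 0<ε)
                 | cauchy y (½ ℚ.* ε) (0<½*ε 0<ε)
  ... | M , p | N , q = M ⊔ N , λ m n M⊔N≤m M⊔N≤n → begin-strict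
    ℚ.∣ (seq x m ℚ.+ seq y m) ℚ.- (seq x n ℚ.+ seq y n) ∣
      ≡⟨ cong ℚ.∣_∣ (+-interchange-- (seq x m) (seq y m) (seq x n) (seq y n)) ⟩
    ℚ.∣ (seq x m ℚ.- seq x n) ℚ.+ (seq y m ℚ.- seq y n) ∣
      ≤⟨ ℚₚ.∣p+q∣≤∣p∣+∣q∣ (seq x m ℚ.- seq x n) (seq y m ℚ.- seq y n) ⟩
    ℚ.∣ seq x m ℚ.- seq x n ∣ ℚ.+ ℚ.∣ seq y m ℚ.- seq y n ∣
      <⟨ ℚₚ.+-mono-<
           (p m n (ℕₚ.m⊔n≤o⇒m≤o M N M⊔N≤m) (ℕₚ.m⊔n≤o⇒m≤o M N M⊔N≤n))
           (q m n (ℕₚ.m⊔n≤o⇒n≤o M N M⊔N≤m) (ℕₚ.m⊔n≤o⇒n≤o M N M⊔N≤n)) ⟩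
    ½ ℚ.* ε ℚ.+ ½ ℚ.* ε
      ≡⟨ ½*ε+½*ε ε ⟩
    ε ∎
    where open ℚₚ.≤-Reasoning

-_ : ℝ → ℝ
- x = mkℝ (λ n → ℚ.- seq x n) bound
  where
  bound : ∀ ε → 0ℚ ℚ.< ε → ∃[ N ] ∀ m n → N ℕ.≤ m → N ℕ.≤ n →
          ℚ.∣ ℚ.- seq x m ℚ.- ℚ.- seq x n ∣ ℚ.< ε
  bound ε 0<ε with cauchy x ε 0<ε
  ... | N , p = N , λ m n N≤m N≤n →
    subst (ℚ._< ε)
      (sym (trans (cong ℚ.∣_∣ (neg-swap (seq x m) (seq x n)))
                  (ℚₚ.∣-p∣≡∣p∣ (seq x m ℚ.- seq x n))))
      (p m n N≤m N≤n)

_-_ : ℝ → ℝ → ℝ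
x - y = x + - y

∣_∣ : ℝ → ℝ
∣ x ∣ = mkℝ (λ n → ℚ.∣ seq x n ∣) bound
  where
  bound : ∀ ε → 0ℚ ℚ.< ε → ∃[ N ] ∀ m n → N ℕ.≤ m → N ℕ.≤ n →
          ℚ.∣ ℚ.∣ seq x m ∣ ℚ.- ℚ.∣ seq x n ∣ ∣ ℚ.< ε
  bound ε 0<ε with cauchy x ε 0<ε
  ... | N , p = N , λ m n N≤m N≤n →
    ℚₚ.≤-<-trans (∣∣a∣-∣b∣∣≤∣a-b∣ (seq x m) (seq x n)) (p m n N≤m N≤n)

_<_ : ℝ → ℝ → Set
x < y = ∃[ δ ] 0ℚ ℚ.< δ × ∃[ N ] ∀ n → N ℕ.≤ n → seq x n ℚ.+ δ ℚ.< seq y n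

------------------------------------------------------------------------
-- Limits and series

ConvergesTo : (ℕ → ℝ) → ℝ → Set
ConvergesTo s l = ∀ ε → 0ℝ < ε → ∃[ N ] ∀ n → N ℕ.≤ n → ∣ s n - l ∣ < ε

Converges : (ℕ → ℝ) → Set
Converges s = ∃[ l ] ConvergesTo s l

Diverges : (ℕ → ℝ) → Set
Diverges s = ¬ Converges s

TendsTo+∞ : (ℕ → ℝ) → Set
TendsTo+∞ s = ∀ b → ∃[ N ] ∀ n → N ℕ.≤ n → b < s n

TendsTo-∞ : (ℕ → ℝ) → Set
TendsTo-∞ s = ∀ b → ∃[ N ] ∀ n → N ℕ.≤ n → s n < b

DivergesToInfinity : (ℕ → ℝ) → Set
DivergesToInfinity s = TendsTo+∞ s ⊎ TendsTo-∞ s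

Oscillates : (ℕ → ℝ) → Set
Oscillates s = ¬ Converges s × ¬ TendsTo+∞ s × ¬ TendsTo-∞ s

partialSum : (ℕ → ℝ) → ℕ → ℝ
partialSum a zero    = 0ℝ
partialSum a (suc n) = partialSum a n + a n

ConditionallyConvergent : (ℕ → ℝ) → Set
ConditionallyConvergent a =
  Converges (partialSum a) × ¬ Converges (partialSum (∣_∣ ∘ a))

------------------------------------------------------------------------
-- Subsets and subseries

-- Subsets are given by characteristic functions.  Under excluded middle
-- these are all the subsets, and under function extensionality _≡_ is
-- equality of subsets.

𝒫 : Set → Set
𝒫 X = X → Bool

Elements : {X : Set} → 𝒫 X → Set
Elements {X} 𝒜 = Σ[ x ∈ X ] T (𝒜 x)

Enumerates : (ℕ → ℕ) → 𝒫 ℕ → Set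
Enumerates e A =
  (∀ k → e k ℕ.< e (suc k)) × (∀ n → T (A n) ⇔ (∃[ k ] e k ≡ n))

-- The subseries of a along A has partial sums with property D.  A finite
-- set has no strictly increasing enumeration by ℕ, so finite subseries
-- never satisfy this; for infinite A the enumeration is unique.

Subseries : ((ℕ → ℝ) → Set) → (ℕ → ℝ) → 𝒫 ℕ → Set
Subseries D a A = ∃[ e ] Enumerates e A × D (partialSum (a ∘ e))

------------------------------------------------------------------------
-- The subseries numbers

-- A cardinal is represented by any type of that cardinality, with
-- κ ↣ μ for κ ≤ μ and κ ↔ μ for equality of cardinals.

IsLeastCardinality : {X : Set} → (𝒫 X → Set) → Set → Set
IsLeastCardinality P κ =
  (∃[ 𝒜 ] P 𝒜 × (κ ↔ Elements 𝒜)) × (∀ 𝒜 → P 𝒜 → κ ↣ Elements 𝒜)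

Admissible : ((ℕ → ℝ) → Set) → 𝒫 (𝒫 ℕ) → Set
Admissible D 𝒜 =
  ∀ a → ConditionallyConvergent a → ∃[ A ] T (𝒜 A) × Subseries D a A

Is-ß : Set → Set
Is-ß = IsLeastCardinality (Admissible Diverges)

Is-ßᵢ : Set → Set
Is-ßᵢ = IsLeastCardinality (Admissible DivergesToInfinity)

Is-ßₒ : Set → Set
Is-ßₒ = IsLeastCardinality (Admissible Oscillates)

-- 2^ℵ₀.
𝔠 : Set
𝔠 = 𝒫 ℕ

{-# OPTIONS --safe #-}
module Submission where

-- Every conditionally convergent series ∑ aₙ has a subseries that tends to
-- infinity and one that oscillates, so the family of all sets of naturals
-- witnesses the upper bound 𝔠.  Choose rationals qₙ with ∣aₙ - qₙ∣ ≤ 2⁻⁽ⁿ⁺¹⁾: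
-- partial sums of corresponding subseries of a and q differ by at most 1.
-- The partial sums of q are bounded and those of ∣q∣ are not, so the
-- positive and the negative parts of q both have unbounded sums.  The
-- positive terms give a subseries tending to +∞; collecting positive terms
-- until the sum exceeds 3, then negative ones until it is below -3, and so
-- on, gives an oscillating one.
--
-- That a least cardinality exists is Hönig's argument: given sets (Aᵢ), take
-- a maximal S ⊆ ∏ Aᵢ on which all projections are injective.  Some
-- projection πᵢ maps S onto Aᵢ, since otherwise S could be enlarged, and
-- then πⱼ ∘ πᵢ⁻¹ embeds Aᵢ into each Aⱼ.

open import Axiom.ExcludedMiddle using (ExcludedMiddle)
open import Axiom.Extensionality.Propositional using (Extensionality)
open import Data.Bool.Base using (Bool; true; false; T; not)
import Data.Bool.Properties as Boolₚ
open import Data.Empty using (⊥; ⊥-elim)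
import Data.Integer.Base as ℤ
import Data.Integer.Properties as ℤₚ
open import Data.Nat.Base as ℕ using (ℕ; zero; suc; _⊔_; z≤n)
import Data.Nat.Properties as ℕₚ
open import Data.Product.Base using (∃-syntax; _×_; _,_; proj₁; proj₂)
open import Data.Rational.Base as ℚ using (ℚ; mkℚ; 0ℚ; 1ℚ; ½; toℚᵘ)
import Data.Rational.Properties as ℚₚ
open import Data.Rational.Solver using (module +-*-Solver)
open import Data.Rational.Unnormalised.Base as ℚᵘ using (mkℚᵘ; *≡*; *<*)
import Data.Rational.Unnormalised.Properties as ℚᵘₚ
open import Data.Sum.Base using (_⊎_; inj₁; inj₂)
open import Function.Base using (_∘_; id)
open import Function.Bundles using (_↣_; mk⇔; mk↣)
open import Function.Construct.Identity using (↔-id)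
open import Level using (0ℓ)
open import Relation.Binary.Definitions using (tri<; tri≈; tri>)
open import Relation.Binary.PropositionalEquality
  using (_≡_; refl; sym; trans; cong; cong₂; subst; subst₂; module ≡-Reasoning)
open import Relation.Nullary.Decidable.Core
  using (Dec; yes; no; isYes; toWitness; fromWitness; T?)
open import Relation.Nullary.Negation.Core using (¬_)
open import Defs
open +-*-Solver

-- Least cardinalities

module Classical (em : ExcludedMiddle 0ℓ) where

  ⟪_⟫ : {X : Set} → (X → Set) → 𝒫 X
  ⟪ P ⟫ x = isYes (em {P x})

  ∈⁺ : {P : Set} → P → T (isYes (em {P}))
  ∈⁺ = fromWitness

  ∈⁻ : {P : Set} → T (isYes (em {P})) → P
  ∈⁻ = toWitness

  ¬∀⇒∃¬ : {X : Set} {P : X → Set} → ¬ (∀ x → P x) → ∃[ x ] ¬ P x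
  ¬∀⇒∃¬ {P = P} ¬∀ with em {∃[ x ] ¬ P x}
  ... | yes ∃¬ = ∃¬
  ... | no ¬∃¬ = ⊥-elim (¬∀ λ x → dne λ ¬p → ¬∃¬ (x , ¬p))
    where
    dne : ∀ {x} → ¬ ¬ P x → P x
    dne {x} ¬¬p with em {P x}
    ... | yes p = p
    ... | no ¬p = ⊥-elim (¬¬p ¬p)

  module Subsets (X : Set) where

    _⊆_ : 𝒫 X → 𝒫 X → Set
    S ⊆ S′ = ∀ x → T (S x) → T (S′ x)

    ⋃ : 𝒫 (𝒫 X) → 𝒫 X
    ⋃ F = ⟪ (λ x → ∃[ S ] T (F S) × T (S x)) ⟫

    -- The Bourbaki-Witt fixed point theorem for subsets.

    module BourbakiWitt (ext : Extensionality 0ℓ 0ℓ)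
      (f : 𝒫 X → 𝒫 X) (inflationary : ∀ S → S ⊆ f S) where

      -- Stands in for the transfinite iteration of `f`. The empty set, where the iteration starts,
      -- is the limit of the empty family.
      data Tower : 𝒫 X → Set where
        succ : ∀ {S} → Tower S → Tower (f S)
        lim  : ∀ F → (∀ S → T (F S) → Tower S) → Tower (⋃ F)

      ⊆-antisym : ∀ {S S′ : 𝒫 X} → S ⊆ S′ → S′ ⊆ S → S ≡ S′
      ⊆-antisym {S} {S′} p q = ext λ x → bool (S x) (S′ x) (p x) (q x)
        where
        bool : ∀ b c → (T b → T c) → (T c → T b) → b ≡ c
        bool false false _ _ = refl
        bool false true  _ h = ⊥-elim (h _)
        bool true  false h _ = ⊥-elim (h _)
        bool true  true  _ _ = refl

      ∈⇒⊆⋃ : ∀ F {S} → T (F S) → S ⊆ ⋃ F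
      ∈⇒⊆⋃ F {S} S∈F x x∈S = ∈⁺ (S , S∈F , x∈S)

      ⋃⊆ : ∀ F {S′} → (∀ S → T (F S) → S ⊆ S′) → ⋃ F ⊆ S′
      ⋃⊆ F h x x∈⋃ with ∈⁻ x∈⋃
      ... | S , S∈F , x∈S = h S S∈F x x∈S

      Extreme : 𝒫 X → Set
      Extreme S = ∀ {S′} → Tower S′ → S′ ⊆ S → S ⊆ S′ ⊎ f S′ ⊆ S

      -- Induction on the tower proof for `S′`. A successor cannot jump over `S`, since extremeness
      -- gives `f S′ ⊆ S` or makes `S′` equal to `S`. A union either has a member containing `f S`
      -- or lies inside `S`.
      extreme-comparable : ∀ {S} → Extreme S → ∀ {S′} → Tower S′ → S′ ⊆ S ⊎ f S ⊆ S′
      extreme-comparable {S} eS (succ {S′} t) with extreme-comparable eS t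
      ... | inj₂ fS⊆S′ = inj₂ λ x → inflationary S′ x ∘ fS⊆S′ x
      ... | inj₁ S′⊆S with eS t S′⊆S
      ...   | inj₂ fS′⊆S = inj₁ fS′⊆S
      ...   | inj₁ S⊆S′ =
        inj₂ (subst (λ Z → f Z ⊆ f S′) (⊆-antisym S′⊆S S⊆S′) (λ _ → id))
      extreme-comparable {S} eS (lim F t) with em {∃[ S′ ] T (F S′) × f S ⊆ S′}
      ... | yes (S′ , S′∈F , fS⊆S′) = inj₂ λ x → ∈⇒⊆⋃ F S′∈F x ∘ fS⊆S′ x
      ... | no none = inj₁ (⋃⊆ F below)
        where
        below : ∀ S′ → T (F S′) → S′ ⊆ S
        below S′ S′∈F with extreme-comparable eS (t S′ S′∈F)
        ... | inj₁ S′⊆S = S′⊆S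
        ... | inj₂ fS⊆S′ = ⊥-elim (none (S′ , S′∈F , fS⊆S′))

      extreme : ∀ {S} → Tower S → Extreme S
      extreme (succ {S} t) {S′} t′ S′⊆fS with extreme-comparable (extreme t) t′
      ... | inj₂ fS⊆S′ = inj₁ fS⊆S′
      ... | inj₁ S′⊆S with extreme t t′ S′⊆S
      ...   | inj₁ S⊆S′ =
        inj₂ (subst (λ Z → f S′ ⊆ f Z) (⊆-antisym S′⊆S S⊆S′) (λ _ → id))
      ...   | inj₂ fS′⊆S = inj₂ λ x → inflationary S x ∘ fS′⊆S x
      extreme (lim F t) {S′} t′ S′⊆⋃ with em {∃[ S ] T (F S) × S′ ⊆ S}
      ... | no none = inj₁ (⋃⊆ F below)
        where
        below : ∀ S → T (F S) → S ⊆ S′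
        below S S∈F with extreme-comparable (extreme (t S S∈F)) t′
        ... | inj₁ S′⊆S = ⊥-elim (none (S , S∈F , S′⊆S))
        ... | inj₂ fS⊆S′ = λ x → fS⊆S′ x ∘ inflationary S x
      ... | yes (S , S∈F , S′⊆S) with extreme (t S S∈F) t′ S′⊆S
      ...   | inj₂ fS′⊆S = inj₂ λ x → ∈⇒⊆⋃ F S∈F x ∘ fS′⊆S x
      -- Now `S′` equals `S`, and comparing the union itself with the extreme set `S` decides
      -- whether the union goes beyond it.
      ...   | inj₁ S⊆S′ with extreme-comparable (extreme (t S S∈F)) (lim F t)
      ...     | inj₁ ⋃⊆S = inj₁ λ x → S⊆S′ x ∘ ⋃⊆S x
      ...     | inj₂ fS⊆⋃ =
        inj₂ (subst (λ Z → f Z ⊆ ⋃ F) (⊆-antisym S⊆S′ S′⊆S) fS⊆⋃)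

      ⊆-total : ∀ {S S′} → Tower S → Tower S′ → S ⊆ S′ ⊎ S′ ⊆ S
      ⊆-total {S} t t′ with extreme-comparable (extreme t) t′
      ... | inj₁ S′⊆S = inj₂ S′⊆S
      ... | inj₂ fS⊆S′ = inj₁ λ x → fS⊆S′ x ∘ inflationary S x

      -- Excluded middle turns `Tower` into a Boolean family, so the union of the whole tower is
      -- again in the tower, and `f` adds nothing to it.
      top : 𝒫 X
      top = ⋃ ⟪ Tower ⟫

      top∈Tower : Tower top
      top∈Tower = lim ⟪ Tower ⟫ λ _ → ∈⁻

      f-top⊆top : f top ⊆ top
      f-top⊆top = ∈⇒⊆⋃ ⟪ Tower ⟫ (∈⁺ (succ top∈Tower))

  -- Hönig's argument for least cardinalities.

  module LeastCardinal (ext : Extensionality 0ℓ 0ℓ) {I : Set} (A : I → Set) where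

    Y : Set
    Y = ∀ i → A i

    Free : 𝒫 Y → Set
    Free S = ∀ i → ∃[ a ] ¬ (∃[ y ] T (S y) × y i ≡ a)

    -- Different proofs of `Free S` may name different missed values. Indexing by the decision fixes
    -- one proof, so `extend` adds at most one point at a time.
    data New (S : 𝒫 Y) : Dec (Free S) → Y → Set where
      new : (free : Free S) → New S (yes free) (proj₁ ∘ free)

    extend : 𝒫 Y → 𝒫 Y
    extend S = ⟪ (λ y → T (S y) ⊎ New S em y) ⟫

    open Subsets Y
    open BourbakiWitt ext extend (λ S y → ∈⁺ ∘ inj₁)

    InjectiveProjections : 𝒫 Y → Set
    InjectiveProjections S = ∀ i {y z} → T (S y) → T (S z) → y i ≡ z i → y ≡ z

    New-unique : ∀ {S d y z} → New S d y → New S d z → y ≡ z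
    New-unique (new _) (new _) = refl

    New-fresh : ∀ {S d y z} → New S d y → T (S z) → ∀ i → ¬ z i ≡ y i
    New-fresh (new free) z∈S i eq = proj₂ (free i) (_ , z∈S , eq)

    -- A new point differs from every old one in each coordinate. For a union, totality of the tower
    -- puts both points into a single member.
    tower-injective : ∀ {S} → Tower S → InjectiveProjections S
    tower-injective (succ t) i y∈ z∈ eq with ∈⁻ y∈ | ∈⁻ z∈
    ... | inj₁ y∈S | inj₁ z∈S = tower-injective t i y∈S z∈S eq
    ... | inj₁ y∈S | inj₂ z-new = ⊥-elim (New-fresh z-new y∈S i eq)
    ... | inj₂ y-new | inj₁ z∈S = ⊥-elim (New-fresh y-new z∈S i (sym eq))
    ... | inj₂ y-new | inj₂ z-new = New-unique y-new z-new
    tower-injective (lim F t) i y∈ z∈ eq with ∈⁻ y∈ | ∈⁻ z∈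
    ... | S , S∈F , y∈S | S′ , S′∈F , z∈S′ with ⊆-total (t S S∈F) (t S′ S′∈F)
    ...   | inj₁ S⊆S′ = tower-injective (t S′ S′∈F) i (S⊆S′ _ y∈S) z∈S′ eq
    ...   | inj₂ S′⊆S = tower-injective (t S S∈F) i y∈S (S′⊆S _ z∈S′) eq

    -- Otherwise the new point lies in `extend top`, hence in `top`, and so differs from itself at
    -- the index `i`.
    top-not-free : I → ¬ Free top
    top-not-free i free = go em refl
      where
      go : (d : Dec (Free top)) → em ≡ d → ⊥
      go (no ¬free) _ = ¬free free
      go (yes free′) eq = New-fresh is-new (f-top⊆top _ (∈⁺ (inj₂ is-new))) i refl
        where
        is-new : New top em (proj₁ ∘ free′)
        is-new = subst (λ d → New top d _) (sym eq) (new free′)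

    least : I → ∃[ i ] ∀ j → A i ↣ A j
    least i₀ with ¬∀⇒∃¬ (top-not-free i₀)
    ... | i , ¬free-i = i , λ j → mk↣ (injective j)
      where
      hit : ∀ a → ∃[ y ] T (top y) × y i ≡ a
      hit a with em {∃[ y ] T (top y) × y i ≡ a}
      ... | yes h = h
      ... | no ¬h = ⊥-elim (¬free-i (a , ¬h))
      injective : ∀ j {a b} → proj₁ (hit a) j ≡ proj₁ (hit b) j → a ≡ b
      injective j {a} {b} eq with hit a | hit b
      ... | y , y∈ , refl | z , z∈ , refl =
        cong (λ w → w i) (tower-injective top∈Tower j y∈ z∈ eq)

-- Rationals

-- Linear arithmetic over ℚ: add up the hypotheses to a ≤ b, then let the
-- ring solver check y - x ≡ b - a.
≤-by : ∀ {a b x y} → a ℚ.≤ b → y ℚ.- x ≡ b ℚ.- a → x ℚ.≤ y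
≤-by {a} {b} {x} {y} a≤b eq = subst₂ ℚ._≤_
  (solve 2 (λ a x → a :+ (x :- a) := x) refl a x)
  (trans (solve 3 (λ a b x → b :+ (x :- a) := (b :- a) :+ x) refl a b x)
    (trans (cong (ℚ._+ x) (sym eq)) (solve 2 (λ x y → (y :- x) :+ x := y) refl x y)))
  (ℚₚ.+-monoˡ-≤ (x ℚ.- a) a≤b)

<-by : ∀ {a b x y} → a ℚ.< b → y ℚ.- x ≡ b ℚ.- a → x ℚ.< y
<-by {a} {b} {x} {y} a<b eq = subst₂ ℚ._<_
  (solve 2 (λ a x → a :+ (x :- a) := x) refl a x)
  (trans (solve 3 (λ a b x → b :+ (x :- a) := (b :- a) :+ x) refl a b x)
    (trans (cong (ℚ._+ x) (sym eq)) (solve 2 (λ x y → (y :- x) :+ x := y) refl x y)))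
  (ℚₚ.+-monoˡ-< (x ℚ.- a) a<b)

x≤∣x∣ : ∀ x → x ℚ.≤ ℚ.∣ x ∣
x≤∣x∣ x with ℚₚ.≤-total 0ℚ x
... | inj₁ 0≤x = ℚₚ.≤-reflexive (sym (ℚₚ.0≤p⇒∣p∣≡p 0≤x))
... | inj₂ x≤0 = ℚₚ.≤-trans x≤0 (ℚₚ.0≤∣p∣ x)

-x≤∣x∣ : ∀ x → ℚ.- x ℚ.≤ ℚ.∣ x ∣
-x≤∣x∣ x = subst (ℚ.- x ℚ.≤_) (ℚₚ.∣-p∣≡∣p∣ x) (x≤∣x∣ (ℚ.- x))

∣x∣≤ : ∀ {x c} → x ℚ.≤ c → ℚ.- x ℚ.≤ c → ℚ.∣ x ∣ ℚ.≤ c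
∣x∣≤ {x} x≤c -x≤c with ℚₚ.∣p∣≡p∨∣p∣≡-p x
... | inj₁ eq = subst (ℚ._≤ _) (sym eq) x≤c
... | inj₂ eq = subst (ℚ._≤ _) (sym eq) -x≤c

∣x∣-∣y∣≤∣x-y∣ : ∀ x y → ℚ.∣ x ∣ ℚ.- ℚ.∣ y ∣ ℚ.≤ ℚ.∣ x ℚ.- y ∣
∣x∣-∣y∣≤∣x-y∣ x y = ≤-by
  (subst (λ z → ℚ.∣ z ∣ ℚ.≤ ℚ.∣ x ℚ.- y ∣ ℚ.+ ℚ.∣ y ∣)
    (solve 2 (λ x y → (x :- y) :+ y := x) refl x y)
    (ℚₚ.∣p+q∣≤∣p∣+∣q∣ (x ℚ.- y) y))
  (solve 3 (λ a b d → d :- (a :- b) := (d :+ b) :- a) refl ℚ.∣ x ∣ ℚ.∣ y ∣ ℚ.∣ x ℚ.- y ∣)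

∣x-y∣≡∣y-x∣ : ∀ x y → ℚ.∣ x ℚ.- y ∣ ≡ ℚ.∣ y ℚ.- x ∣
∣x-y∣≡∣y-x∣ x y = trans (sym (ℚₚ.∣-p∣≡∣p∣ (x ℚ.- y)))
  (cong ℚ.∣_∣ (solve 2 (λ x y → :- (x :- y) := y :- x) refl x y))

∣∣x∣-∣y∣∣≤∣x-y∣ : ∀ x y → ℚ.∣ ℚ.∣ x ∣ ℚ.- ℚ.∣ y ∣ ∣ ℚ.≤ ℚ.∣ x ℚ.- y ∣
∣∣x∣-∣y∣∣≤∣x-y∣ x y = ∣x∣≤ (∣x∣-∣y∣≤∣x-y∣ x y) (subst₂ ℚ._≤_
  (solve 2 (λ a b → b :- a := :- (a :- b)) refl ℚ.∣ x ∣ ℚ.∣ y ∣)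
  (∣x-y∣≡∣y-x∣ y x)
  (∣x∣-∣y∣≤∣x-y∣ y x))

fromℕ : ℕ → ℚ
fromℕ zero    = 0ℚ
fromℕ (suc n) = 1ℚ ℚ.+ fromℕ n

toℚᵘ-fromℕ : ∀ n → toℚᵘ (fromℕ n) ℚᵘ.≃ mkℚᵘ (ℤ.+ n) 0
toℚᵘ-fromℕ zero = *≡* refl
toℚᵘ-fromℕ (suc n) = ℚᵘₚ.≃-trans (ℚₚ.toℚᵘ-homo-+ 1ℚ (fromℕ n))
  (ℚᵘₚ.≃-trans (ℚᵘₚ.+-congʳ (toℚᵘ 1ℚ) (toℚᵘ-fromℕ n))
    (*≡* (cong (λ k → (ℤ.+ 1 ℤ.+ k) ℤ.* ℤ.+ 1) (ℤₚ.*-identityʳ (ℤ.+ n)))))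

<fromℕ : ∀ p → ∃[ n ] p ℚ.< fromℕ n
<fromℕ p = bound p , ℚₚ.toℚᵘ-cancel-<
  (ℚᵘₚ.<-respʳ-≃ (ℚᵘₚ.≃-sym (toℚᵘ-fromℕ (bound p))) (below p))
  where
  bound : ℚ → ℕ
  bound (mkℚ (ℤ.+ m) _ _)    = suc m
  bound (mkℚ ℤ.-[1+ _ ] _ _) = 0
  below : ∀ p → toℚᵘ p ℚᵘ.< mkℚᵘ (ℤ.+ bound p) 0
  below (mkℚ (ℤ.+ m) d _) = *<* (subst₂ ℤ._<_
    (ℤₚ.pos-* m 1) (ℤₚ.pos-* (suc m) (suc d))
    (ℤ.+<+ (ℕₚ.<-≤-trans (ℕ.s≤s (ℕₚ.≤-reflexive (ℕₚ.*-identityʳ m))) (ℕₚ.m≤m*n (suc m) (suc d)))))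
  below (mkℚ ℤ.-[1+ m ] d _) = *<* ℤ.-<+

archimedean : ∀ {ε} B → 0ℚ ℚ.< ε → ∃[ n ] B ℚ.< fromℕ n ℚ.* ε
archimedean {ε} B 0<ε = proj₁ big , subst (ℚ._< fromℕ (proj₁ big) ℚ.* ε)
  (trans (ℚₚ.*-assoc B (ℚ.1/ ε) ε)
    (trans (cong (B ℚ.*_) (ℚₚ.*-inverseˡ ε)) (ℚₚ.*-identityʳ B)))
  (ℚₚ.*-monoˡ-<-pos ε (proj₂ big))
  where
  instance
    ε-pos : ℚ.Positive ε
    ε-pos = ℚ.positive 0<ε
    ε-nonZero : ℚ.NonZero ε
    ε-nonZero = ℚₚ.pos⇒nonZero ε
  big : ∃[ n ] B ℚ.* ℚ.1/ ε ℚ.< fromℕ n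
  big = <fromℕ (B ℚ.* ℚ.1/ ε)

-- halves n = 2⁻⁽ⁿ⁺¹⁾, so that the sum over all n is 1.
halves : ℕ → ℚ
halves zero    = ½
halves (suc n) = ½ ℚ.* halves n

0<½* : ∀ {ε} → 0ℚ ℚ.< ε → 0ℚ ℚ.< ½ ℚ.* ε
0<½* {ε} 0<ε = subst (ℚ._< ½ ℚ.* ε) (ℚₚ.*-zeroʳ ½) (ℚₚ.*-monoʳ-<-pos ½ 0<ε)

halves-pos : ∀ n → 0ℚ ℚ.< halves n
halves-pos zero    = ℚₚ.positive⁻¹ ½
halves-pos (suc n) = 0<½* (halves-pos n)

halves-antitone : ∀ {m n} → m ℕ.≤ n → halves n ℚ.≤ halves m
halves-antitone m≤n = go (ℕₚ.≤⇒≤′ m≤n)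
  where
  go : ∀ {m n} → m ℕ.≤′ n → halves n ℚ.≤ halves m
  go ℕ.≤′-refl = ℚₚ.≤-refl
  go (ℕ.≤′-step {n} m≤n) = ℚₚ.≤-trans
    (≤-by (ℚₚ.<⇒≤ (0<½* (halves-pos n)))
      (solve 1 (λ h → h :- con ½ :* h := con ½ :* h :- con 0ℚ) refl (halves n)))
    (go m≤n)

halves≤1 : ∀ n → halves n ℚ.≤ 1ℚ
halves≤1 n = ℚₚ.≤-trans (halves-antitone (z≤n {n})) (ℚₚ.≤ᵇ⇒≤ _)

sum : (ℕ → ℚ) → ℕ → ℚ
sum f zero    = 0ℚ
sum f (suc n) = sum f n ℚ.+ f n

sum-mono-≤ : ∀ {f g} → (∀ n → f n ℚ.≤ g n) → ∀ n → sum f n ℚ.≤ sum g n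
sum-mono-≤ f≤g zero    = ℚₚ.≤-refl
sum-mono-≤ f≤g (suc n) = ℚₚ.+-mono-≤ (sum-mono-≤ f≤g n) (f≤g n)

sum-monotone : ∀ {f} → (∀ n → 0ℚ ℚ.≤ f n) → ∀ {m n} → m ℕ.≤ n → sum f m ℚ.≤ sum f n
sum-monotone {f} 0≤f m≤n = go (ℕₚ.≤⇒≤′ m≤n)
  where
  go : ∀ {m n} → m ℕ.≤′ n → sum f m ℚ.≤ sum f n
  go ℕ.≤′-refl = ℚₚ.≤-refl
  go (ℕ.≤′-step {n} m≤n) = ℚₚ.≤-trans (go m≤n)
    (≤-by (0≤f n) (solve 2 (λ s x → (s :+ x) :- s := x :- con 0ℚ) refl (sum f n) (f n)))

sum-halves : ∀ n → sum halves n ≡ 1ℚ ℚ.- (halves n ℚ.+ halves n)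
sum-halves zero    = refl
sum-halves (suc n) = trans (cong (ℚ._+ halves n) (sum-halves n))
  (solve 1 (λ h → (con 1ℚ :- (h :+ h)) :+ h :=
                  con 1ℚ :- (con ½ :* h :+ con ½ :* h)) refl (halves n))

sum-halves≤1 : ∀ n → sum halves n ℚ.≤ 1ℚ
sum-halves≤1 n = ≤-by (ℚₚ.+-mono-≤ 0≤h 0≤h)
  (trans (cong (λ s → 1ℚ ℚ.- s) (sum-halves n))
    (solve 1 (λ h → con 1ℚ :- (con 1ℚ :- (h :+ h)) := (h :+ h) :- (con 0ℚ :+ con 0ℚ))
      refl (halves n)))
  where
  0≤h : 0ℚ ℚ.≤ halves n
  0≤h = ℚₚ.<⇒≤ (halves-pos n)

n*halves≤1 : ∀ n → fromℕ n ℚ.* halves n ℚ.≤ 1ℚ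
n*halves≤1 zero = ℚₚ.nonNegative⁻¹ 1ℚ
n*halves≤1 (suc n) = ≤-by
  (ℚₚ.*-monoˡ-≤-nonNeg ½ (ℚₚ.+-mono-≤ (n*halves≤1 n) (halves≤1 n)))
  (solve 2 (λ k h → con 1ℚ :- (con 1ℚ :+ k) :* (con ½ :* h) :=
       con ½ :* (con 1ℚ :+ con 1ℚ) :- con ½ :* (k :* h :+ h)) refl (fromℕ n) (halves n))

-- For `n` with `1 < n ε`, the inequality `ε ≤ halves n` multiplied by `n` contradicts `n*halves≤1`.
halves→0 : ∀ {ε} → 0ℚ ℚ.< ε → ∃[ n ] halves n ℚ.< ε
halves→0 {ε} 0<ε using n , 1<nε ← archimedean 1ℚ 0<ε = n , ℚₚ.≰⇒> λ ε≤h → ℚₚ.<-irrefl refl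
  (ℚₚ.<-≤-trans 1<nε (ℚₚ.≤-trans (ℚₚ.*-monoˡ-≤-nonNeg (fromℕ n) ε≤h) (n*halves≤1 n)))
  where
  instance
    n-nonNeg : ℚ.NonNegative (fromℕ n)
    n-nonNeg = ℚ.nonNegative (0≤fromℕ n)
      where
      0≤fromℕ : ∀ n → 0ℚ ℚ.≤ fromℕ n
      0≤fromℕ zero = ℚₚ.≤-refl
      0≤fromℕ (suc n) = ℚₚ.+-mono-≤ {0ℚ} {1ℚ} (ℚₚ.nonNegative⁻¹ 1ℚ) (0≤fromℕ n)

-- Reals and rational approximations

-- The bound is non-strict, so that rational constants have error 0 and errors simply add up.
record Near (x : ℝ) (p ε : ℚ) : Set where
  constructor near
  field
    index : ℕ
    bound : ∀ j → index ℕ.≤ j → ℚ.∣ seq x j ℚ.- p ∣ ℚ.≤ ε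

open Near

near-upper : ∀ {x p ε} (h : Near x p ε) j → index h ℕ.≤ j → seq x j ℚ.≤ p ℚ.+ ε
near-upper {x} {p} {ε} (near N h) j N≤j =
  ≤-by (ℚₚ.≤-trans (x≤∣x∣ (seq x j ℚ.- p)) (h j N≤j))
    (solve 3 (λ x p ε → (p :+ ε) :- x := ε :- (x :- p)) refl (seq x j) p ε)

near-lower : ∀ {x p ε} (h : Near x p ε) j → index h ℕ.≤ j → p ℚ.- ε ℚ.≤ seq x j
near-lower {x} {p} {ε} (near N h) j N≤j =
  ≤-by (ℚₚ.≤-trans (-x≤∣x∣ (seq x j ℚ.- p)) (h j N≤j))
    (solve 3 (λ x p ε → x :- (p :- ε) := ε :- :- (x :- p)) refl (seq x j) p ε)

near-weaken : ∀ {x p ε δ} → ε ℚ.≤ δ → Near x p ε → Near x p δ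
near-weaken ε≤δ (near N h) = near N λ j N≤j → ℚₚ.≤-trans (h j N≤j) ε≤δ

rational-approximation : ∀ x {ε} → 0ℚ ℚ.< ε → ∃[ p ] Near x p ε
rational-approximation x 0<ε using N , h ← cauchy x _ 0<ε =
  seq x N , near N λ j N≤j → ℚₚ.<⇒≤ (h j N N≤j ℕₚ.≤-refl)

near-+ : ∀ {x y p q ε δ} → Near x p ε → Near y q δ → Near (x + y) (p ℚ.+ q) (ε ℚ.+ δ)
near-+ {x} {y} {p} {q} {ε} {δ} (near M g) (near N h) = near (M ⊔ N) λ j M⊔N≤j → ℚₚ.≤-trans
  (subst (λ z → ℚ.∣ z ∣ ℚ.≤ ℚ.∣ seq x j ℚ.- p ∣ ℚ.+ ℚ.∣ seq y j ℚ.- q ∣)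
    (solve 4 (λ a b p q → (a :- p) :+ (b :- q) := (a :+ b) :- (p :+ q)) refl
      (seq x j) (seq y j) p q)
    (ℚₚ.∣p+q∣≤∣p∣+∣q∣ (seq x j ℚ.- p) (seq y j ℚ.- q)))
  (ℚₚ.+-mono-≤ (g j (ℕₚ.m⊔n≤o⇒m≤o M N M⊔N≤j)) (h j (ℕₚ.m⊔n≤o⇒n≤o M N M⊔N≤j)))

near-neg : ∀ {x p ε} → Near x p ε → Near (- x) (ℚ.- p) ε
near-neg {x} {p} {ε} (near N h) = near N λ j N≤j → subst (ℚ._≤ ε)
  (trans (sym (ℚₚ.∣-p∣≡∣p∣ (seq x j ℚ.- p)))
    (cong ℚ.∣_∣ (solve 2 (λ a p → :- (a :- p) := :- a :- :- p) refl (seq x j) p)))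
  (h j N≤j)

near-∣∣ : ∀ {x p ε} → Near x p ε → Near ∣ x ∣ ℚ.∣ p ∣ ε
near-∣∣ {x} {p} (near N h) = near N λ j N≤j →
  ℚₚ.≤-trans (∣∣x∣-∣y∣∣≤∣x-y∣ (seq x j) p) (h j N≤j)

const : ℚ → ℝ
const p = mkℝ (λ _ → p) λ ε 0<ε → 0 , λ _ _ _ _ →
  subst (λ z → ℚ.∣ z ∣ ℚ.< ε) (sym (ℚₚ.+-inverseʳ p)) 0<ε

near-const : ∀ p → Near (const p) p 0ℚ
near-const p = near 0 λ _ _ → ℚₚ.≤-reflexive (cong ℚ.∣_∣ (ℚₚ.+-inverseʳ p))

near-0ℝ : Near 0ℝ 0ℚ 0ℚ
near-0ℝ = near 0 λ _ _ → ℚₚ.≤-refl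

near-partialSum : ∀ {a q ε} → (∀ n → Near (a n) (q n) (ε n)) →
  ∀ n → Near (partialSum a n) (sum q n) (sum ε n)
near-partialSum h zero = near-0ℝ
near-partialSum {a} {q} {ε} h (suc n) =
  near-+ {partialSum a n} {a n} {sum q n} {q n} {sum ε n} {ε n}
    (near-partialSum {a} {q} {ε} h n) (h n)

near⇒< : ∀ x y {p ε c} → Near x p ε → p ℚ.+ ε ℚ.< c →
  (∃[ N ] ∀ j → N ℕ.≤ j → c ℚ.≤ seq y j) → x < y
near⇒< x y {p} {ε} {c} h gap (N , c≤y) =
  -- Half of the gap serves as the witness for `_<_`; the other half yields strictness.
  γ , 0<½* 0<c-p-ε , index h ⊔ N , λ j ≤j → ℚₚ.<-≤-trans
    (<-by (ℚₚ.+-mono-≤-< (near-upper h j (ℕₚ.m⊔n≤o⇒m≤o (index h) N ≤j)) (0<½* 0<c-p-ε))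
      (solve 3 (λ z b c → c :- (z :+ con ½ :* (c :- b)) :=
          (b :+ con ½ :* (c :- b)) :- (z :+ con 0ℚ)) refl (seq x j) (p ℚ.+ ε) c))
    (c≤y j (ℕₚ.m⊔n≤o⇒n≤o (index h) N ≤j))
  where
  γ : ℚ
  γ = ½ ℚ.* (c ℚ.- (p ℚ.+ ε))
  0<c-p-ε : 0ℚ ℚ.< c ℚ.- (p ℚ.+ ε)
  0<c-p-ε = <-by gap (solve 2 (λ b c → (c :- b) :- con 0ℚ := c :- b) refl (p ℚ.+ ε) c)

near⇒lower-bound : ∀ {x p ε} → Near x p ε → ∃[ N ] ∀ j → N ℕ.≤ j → p ℚ.- ε ℚ.≤ seq x j
near⇒lower-bound h = index h , near-lower h

common-index : ∀ k m n → ∃[ j ] k ℕ.≤ j × m ℕ.≤ j × n ℕ.≤ j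
common-index k m n = k ⊔ (m ⊔ n) , ℕₚ.m≤m⊔n k (m ⊔ n) ,
  ℕₚ.≤-trans (ℕₚ.m≤m⊔n m n) (ℕₚ.m≤n⊔m k (m ⊔ n)) ,
  ℕₚ.≤-trans (ℕₚ.m≤n⊔m m n) (ℕₚ.m≤n⊔m k (m ⊔ n))

<⇒near : ∀ x y {p q ε δ} → x < y → Near x p ε → Near y q δ → p ℚ.- ε ℚ.< q ℚ.+ δ
<⇒near x y (γ , 0<γ , K , x+γ<y) g h
  using j , K≤j , g≤j , h≤j ← common-index K (index g) (index h) =
  ℚₚ.≤-<-trans (near-lower g j g≤j) (ℚₚ.<-≤-trans
    (<-by (ℚₚ.+-mono-< (x+γ<y j K≤j) 0<γ)
      (solve 3 (λ u v c → v :- u := (v :+ c) :- ((u :+ c) :+ con 0ℚ)) refl (seq x j) (seq y j) γ))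
    (near-upper h j h≤j))

-- Subseries of rational series

-- `true` stands for upwards and `false` for downwards, so that one argument treats both signs.
signed : Bool → ℚ → ℚ
signed true  x = x
signed false x = ℚ.- x

signed-+ : ∀ b x y → signed b (x ℚ.+ y) ≡ signed b x ℚ.+ signed b y
signed-+ true  x y = refl
signed-+ false x y = ℚₚ.neg-distrib-+ x y

signed-involutive : ∀ b x → signed b (signed b x) ≡ x
signed-involutive true  x = refl
signed-involutive false x = solve 1 (λ x → :- :- x := x) refl x

signed-0 : ∀ b → signed b 0ℚ ≡ 0ℚ
signed-0 true  = refl
signed-0 false = refl

positivePart : ℚ → ℚ
positivePart x with 0ℚ ℚₚ.<? x
... | yes _ = x
... | no _  = 0ℚ

positivePart-positive : ∀ {x} → 0ℚ ℚ.< x → positivePart x ≡ x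
positivePart-positive {x} 0<x with 0ℚ ℚₚ.<? x
... | yes _ = refl
... | no ≮  = ⊥-elim (≮ 0<x)

positivePart-nonPositive : ∀ {x} → ¬ 0ℚ ℚ.< x → positivePart x ≡ 0ℚ
positivePart-nonPositive {x} 0≮x with 0ℚ ℚₚ.<? x
... | yes 0<x = ⊥-elim (0≮x 0<x)
... | no _    = refl

0≤positivePart : ∀ x → 0ℚ ℚ.≤ positivePart x
0≤positivePart x with 0ℚ ℚₚ.<? x
... | yes 0<x = ℚₚ.<⇒≤ 0<x
... | no _    = ℚₚ.≤-refl

-- This is `x` if its sign is that of `b`, and 0 otherwise; the outer `signed` restores the sign of
-- negative terms.
select : Bool → ℚ → ℚ
select b x = signed b (positivePart (signed b x))

-- Increasing enumerations of infinite sets.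

StrictlyIncreasing : (ℕ → ℕ) → Set
StrictlyIncreasing e = ∀ k → e k ℕ.< e (suc k)

module _ {e : ℕ → ℕ} (e-inc : StrictlyIncreasing e) where

  strictMono : ∀ {i j} → i ℕ.< j → e i ℕ.< e j
  strictMono {i} i<j = go (ℕₚ.≤⇒≤′ i<j)
    where
    go : ∀ {j} → suc i ℕ.≤′ j → e i ℕ.< e j
    go ℕ.≤′-refl = e-inc i
    go (ℕ.≤′-step {n} i<n) = ℕₚ.<-trans (go i<n) (e-inc n)

  strict-injective : ∀ {i j} → e i ≡ e j → i ≡ j
  strict-injective {i} {j} eq with ℕₚ.<-cmp i j
  ... | tri< i<j _ _ = ⊥-elim (ℕₚ.<-irrefl eq (strictMono i<j))
  ... | tri≈ _ i≡j _ = i≡j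
  ... | tri> _ _ j<i = ⊥-elim (ℕₚ.<-irrefl (sym eq) (strictMono j<i))

  strict-cancel-≤ : ∀ {i j} → e i ℕ.≤ e j → i ℕ.≤ j
  strict-cancel-≤ {i} {j} ei≤ej = ℕₚ.≮⇒≥ λ j<i → ℕₚ.<⇒≱ (strictMono j<i) ei≤ej

  strict-expanding : ∀ k → k ℕ.≤ e k
  strict-expanding zero    = z≤n
  strict-expanding (suc k) = ℕₚ.≤-<-trans (strict-expanding k) (e-inc k)

module Enumeration (A : 𝒫 ℕ) (infinite : ∀ n → ∃[ m ] n ℕ.≤ m × T (A m)) where

  FirstFrom : ℕ → ℕ → Set
  FirstFrom n m = n ℕ.≤ m × T (A m) × (∀ k → n ℕ.≤ k → k ℕ.< m → ¬ T (A k))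

  -- The distance `d` to a known member bounds the search.
  search : ∀ d n → T (A (d ℕ.+ n)) → ∃[ m ] FirstFrom n m
  search zero n n∈A = n , ℕₚ.≤-refl , n∈A , λ k n≤k k<n → ⊥-elim (ℕₚ.<⇒≱ k<n n≤k)
  search (suc d) n d+n∈A with T? (A n)
  ... | yes n∈A = n , ℕₚ.≤-refl , n∈A , λ k n≤k k<n → ⊥-elim (ℕₚ.<⇒≱ k<n n≤k)
  ... | no n∉A
    using m , n<m , m∈A , none ← search d (suc n) (subst (T ∘ A) (sym (ℕₚ.+-suc d n)) d+n∈A) =
      m , ℕₚ.<⇒≤ n<m , m∈A , none′
    where
    none′ : ∀ k → n ℕ.≤ k → k ℕ.< m → ¬ T (A k)
    none′ k n≤k k<m with ℕₚ.m≤n⇒m<n∨m≡n n≤k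
    ... | inj₁ n<k  = none k n<k k<m
    ... | inj₂ refl = n∉A

  abstract
    first : ∀ n → ∃[ m ] FirstFrom n m
    first n using m , n≤m , m∈A ← infinite n =
      search (m ℕ.∸ n) n (subst (T ∘ A) (sym (ℕₚ.m∸n+n≡m n≤m)) m∈A)

  next : ℕ → ℕ
  next n = proj₁ (first n)

  next-unique : ∀ {n m} → FirstFrom n m → next n ≡ m
  next-unique {n} {m} (n≤m , m∈A , none) with first n
  ... | m′ , n≤m′ , m′∈A , none′ with ℕₚ.<-cmp m′ m
  ...   | tri< m′<m _ _ = ⊥-elim (none m′ n≤m′ m′<m m′∈A)
  ...   | tri≈ _ eq _ = eq
  ...   | tri> _ _ m<m′ = ⊥-elim (none′ m n≤m m<m′ m∈A)

  next-∈ : ∀ {n} → T (A n) → next n ≡ n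
  next-∈ n∈A = next-unique
    (ℕₚ.≤-refl , n∈A , λ k n≤k k<n → ⊥-elim (ℕₚ.<⇒≱ k<n n≤k))

  next-∉ : ∀ {n} → ¬ T (A n) → next n ≡ next (suc n)
  next-∉ {n} n∉A using m , n<m , m∈A , none ← first (suc n) =
    next-unique (ℕₚ.<⇒≤ n<m , m∈A , none′)
    where
    none′ : ∀ k → n ℕ.≤ k → k ℕ.< m → ¬ T (A k)
    none′ k n≤k k<m with ℕₚ.m≤n⇒m<n∨m≡n n≤k
    ... | inj₁ n<k  = none k n<k k<m
    ... | inj₂ refl = n∉A

  enum : ℕ → ℕ
  enum zero    = next 0
  enum (suc k) = next (suc (enum k))

  enum-∈ : ∀ k → T (A (enum k))
  enum-∈ zero    = proj₁ (proj₂ (proj₂ (first 0)))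
  enum-∈ (suc k) = proj₁ (proj₂ (proj₂ (first (suc (enum k)))))

  enum-increasing : StrictlyIncreasing enum
  enum-increasing k = proj₁ (proj₂ (first (suc (enum k))))

  module _ {q S : ℕ → ℚ} (S-zero : S 0 ≡ 0ℚ)
    (S-∈ : ∀ {n} → T (A n) → S (suc n) ≡ S n ℚ.+ q n)
    (S-∉ : ∀ {n} → ¬ T (A n) → S (suc n) ≡ S n) where

    -- The witness `k` counts the members of `A` below `n`: `S n` has collected exactly those terms,
    -- and `enum k` is the next member.
    sum-enum-next : ∀ n → ∃[ k ] enum k ≡ next n × sum (q ∘ enum) k ≡ S n
    sum-enum-next zero = 0 , refl , sym S-zero
    sum-enum-next (suc n) using k , eq , sum-k ← sum-enum-next n with T? (A n)
    ... | no n∉A = k , trans eq (next-∉ n∉A) , trans sum-k (sym (S-∉ n∉A))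
    ... | yes n∈A =
      suc k , cong (next ∘ suc) ek≡n , trans (cong₂ ℚ._+_ sum-k (cong q ek≡n)) (sym (S-∈ n∈A))
      where
      ek≡n : enum k ≡ n
      ek≡n = trans eq (next-∈ n∈A)

    sum-enum : ∀ k → sum (q ∘ enum) k ≡ S (enum k)
    sum-enum k using k′ , eq , sum-k′ ← sum-enum-next (enum k) =
      subst (λ i → sum (q ∘ enum) i ≡ S (enum k))
        (strict-injective enum-increasing {k′} {k}
          (trans eq (next-∈ {enum k} (enum-∈ k)))) sum-k′

    enum-enumerates : Enumerates enum A
    enum-enumerates = enum-increasing , λ n → mk⇔ (hit n) λ { (k , refl) → enum-∈ k }
      where
      hit : ∀ n → T (A n) → ∃[ k ] enum k ≡ n
      hit n n∈A using k , eq , _ ← sum-enum-next n = k , trans eq (next-∈ n∈A)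

-- `S` is a running sum in which the term `n` counts only if its sign is `b n`. Since `S` changes
-- only at selected indices, `moves` makes the selected set infinite.
module Selection (q : ℕ → ℚ) (b : ℕ → Bool) (S : ℕ → ℚ) (S-zero : S 0 ≡ 0ℚ)
  (S-suc : ∀ n → S (suc n) ≡ S n ℚ.+ select (b n) (q n))
  (moves : ∀ n → ∃[ m ] n ℕ.≤ m × ¬ S m ≡ S n) where

  selected : 𝒫 ℕ
  selected n = isYes (0ℚ ℚₚ.<? signed (b n) (q n))

  S-∈ : ∀ {n} → T (selected n) → S (suc n) ≡ S n ℚ.+ q n
  S-∈ {n} n∈ = trans (S-suc n) (cong (S n ℚ.+_)
    (trans (cong (signed (b n)) (positivePart-positive (toWitness n∈)))
      (signed-involutive (b n) (q n))))

  S-∉ : ∀ {n} → ¬ T (selected n) → S (suc n) ≡ S n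
  S-∉ {n} n∉ = trans (S-suc n) (trans (cong (S n ℚ.+_)
    (trans (cong (signed (b n)) (positivePart-nonPositive (n∉ ∘ fromWitness)))
      (signed-0 (b n)))) (ℚₚ.+-identityʳ (S n)))

  selected-between : ∀ d n → ¬ S (d ℕ.+ n) ≡ S n → ∃[ m ] n ℕ.≤ m × T (selected m)
  selected-between zero    n moved = ⊥-elim (moved refl)
  selected-between (suc d) n moved with T? (selected (d ℕ.+ n))
  ... | yes ∈ = d ℕ.+ n , ℕₚ.m≤n+m n d , ∈
  ... | no ∉  = selected-between d n (moved ∘ trans (S-∉ ∉))

  infinite : ∀ n → ∃[ m ] n ℕ.≤ m × T (selected m)
  infinite n using m , n≤m , moved ← moves n = selected-between (m ℕ.∸ n) n
    (subst (λ k → ¬ S k ≡ S n) (sym (ℕₚ.m∸n+n≡m n≤m)) moved)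

  open Enumeration selected infinite public using (enum; enum-increasing)
  open Enumeration selected infinite using (first)

  enumerates : Enumerates enum selected
  enumerates = Enumeration.enum-enumerates selected infinite {q} {S} S-zero S-∈ S-∉

  sum-enum : ∀ k → sum (q ∘ enum) k ≡ S (enum k)
  sum-enum = Enumeration.sum-enum selected infinite {q} {S} S-zero S-∈ S-∉

  -- Every value `S m` is a partial sum of the subseries, as `S` is constant between selected
  -- indices. Its position `k` satisfies `enum k ≡ next m`, which is at least `m` and so pushes `k`
  -- past `i`.
  attained : ∀ {P : ℚ → Set} → (∀ n → ∃[ m ] n ℕ.≤ m × P (S m)) →
    ∀ i → ∃[ k ] i ℕ.≤ k × P (sum (q ∘ enum) k)
  attained {P} often i
    using m , ei≤m , Pm ← often (enum i)
    using k , eq , sum-k ←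
      Enumeration.sum-enum-next selected infinite {q} {S} S-zero S-∈ S-∉ m = k ,
    strict-cancel-≤ enum-increasing
      (ℕₚ.≤-trans ei≤m (subst (m ℕ.≤_) (sym eq) (proj₁ (proj₂ (first m))))) ,
    subst P (sym sum-k) Pm

-- The threshold fits the refutation of convergence: tolerance 1, error 1 for the partial sums and
-- error 1 for the limit would keep late sums within 3 of one rational, but sums above 3 and below
-- -3 are more than 6 apart.
3ℚ : ℚ
3ℚ = 1ℚ ℚ.+ 1ℚ ℚ.+ 1ℚ

turn : Bool → ℚ → Bool
turn b x with 3ℚ ℚₚ.<? signed b x
... | yes _ = not b
... | no _  = b

turn-beyond : ∀ {b x} → 3ℚ ℚ.< signed b x → turn b x ≡ not b
turn-beyond {b} {x} 3< with 3ℚ ℚₚ.<? signed b x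
... | yes _ = refl
... | no 3≮ = ⊥-elim (3≮ 3<)

turn-below : ∀ {b x} → ¬ 3ℚ ℚ.< signed b x → turn b x ≡ b
turn-below {b} {x} 3≮ with 3ℚ ℚₚ.<? signed b x
... | yes 3< = ⊥-elim (3≮ 3<)
... | no _   = refl

-- The positive variation of the partial sums for `true`, the negative one for `false`.
signedVariation : (ℕ → ℚ) → Bool → ℕ → ℚ
signedVariation q b = sum (λ n → positivePart (signed b (q n)))

module Oscillation (q : ℕ → ℚ)
  (unbounded : ∀ b c n → ∃[ m ] n ℕ.≤ m × c ℚ.< signedVariation q b m) where

  -- The term `n` is selected in direction `direction (suc n)`, fixed after inspecting `S n`; hence
  -- the shift `direction ∘ suc` in the use of `Selection`.
  direction : ℕ → Bool
  S : ℕ → ℚ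

  direction zero    = true
  direction (suc n) = turn (direction n) (S n)

  S zero    = 0ℚ
  S (suc n) = S n ℚ.+ select (turn (direction n) (S n)) (q n)

  F : Bool → ℕ → ℚ
  F = signedVariation q

  -- While the direction b is kept, signed b S grows exactly as the
  -- unbounded F b does.
  target-constant : ∀ b n → direction (suc n) ≡ b →
    (3ℚ ℚ.+ F b (suc n)) ℚ.- signed b (S (suc n)) ≡ (3ℚ ℚ.+ F b n) ℚ.- signed b (S n)
  target-constant b n refl = trans
    (cong (λ s → (3ℚ ℚ.+ F b (suc n)) ℚ.- s)
      (trans (signed-+ b (S n) (select b (q n)))
        (cong (signed b (S n) ℚ.+_) (signed-involutive b p))))
    (solve 4 (λ t f p s → (t :+ (f :+ p)) :- (s :+ p) := (t :+ f) :- s) refl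
      3ℚ (F b n) p (signed b (S n)))
    where
    p : ℚ
    p = positivePart (signed b (q n))

  -- The left side of the inequality is the level that `F b` must pass for `signed b S` to pass 3.
  -- It stays the same until the crossing, so at `d = 0` the inequality says that the crossing has
  -- happened.
  crossing-within : ∀ b d n → direction n ≡ b →
    (3ℚ ℚ.+ F b n) ℚ.- signed b (S n) ℚ.< F b (d ℕ.+ n) →
    ∃[ m ] n ℕ.≤ m × 3ℚ ℚ.< signed b (S m) × direction (suc m) ≡ not b
  crossing-within b d n refl target< with 3ℚ ℚₚ.<? signed b (S n)
  ... | yes 3< = n , ℕₚ.≤-refl , 3< , turn-beyond {b} 3<
  ... | no 3≮ with d
  ...   | zero = ⊥-elim (3≮ (<-by target<
    (solve 3 (λ t f s → s :- t := f :- ((t :+ f) :- s)) refl 3ℚ (F b n) (signed b (S n)))))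
  ...   | suc d′
    using m , n<m , rest ← crossing-within b d′ (suc n) (turn-below {b} 3≮)
      (subst₂ ℚ._<_ (sym (target-constant b n (turn-below {b} 3≮)))
        (cong (F b) (sym (ℕₚ.+-suc d′ n))) target<) =
      m , ℕₚ.<⇒≤ n<m , rest

  crossing : ∀ b n → direction n ≡ b →
    ∃[ m ] n ℕ.≤ m × 3ℚ ℚ.< signed b (S m) × direction (suc m) ≡ not b
  crossing b n eq
    using m , n≤m , target< ← unbounded b ((3ℚ ℚ.+ F b n) ℚ.- signed b (S n)) n =
    crossing-within b (m ℕ.∸ n) n eq
    (subst (λ k → (3ℚ ℚ.+ F b n) ℚ.- signed b (S n) ℚ.< F b k) (sym (ℕₚ.m∸n+n≡m n≤m)) target<)

  -- If the current direction is the wrong one, the next crossing reverses it, and the crossing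
  -- after that is on the side of `b`.
  beyond-often : ∀ b n → ∃[ m ] n ℕ.≤ m × 3ℚ ℚ.< signed b (S m)
  beyond-often b n with direction n Boolₚ.≟ b
  ... | yes eq using m , n≤m , 3< , _ ← crossing b n eq = m , n≤m , 3<
  ... | no neq
    using m , n≤m , _ , turned ← crossing (not b) n (Boolₚ.¬-not neq)
    using k , m<k , 3< , _ ← crossing b (suc m) (trans turned (Boolₚ.not-involutive b)) =
      k , ℕₚ.≤-trans n≤m (ℕₚ.<⇒≤ m<k) , 3<

  -- `S n` cannot equal both a later value above 3 and a later value below -3.
  moves : ∀ n → ∃[ m ] n ℕ.≤ m × ¬ S m ≡ S n
  moves n
    using m , n≤m , 3<Sm ← beyond-often true n
    using k , n≤k , 3<-Sk ← beyond-often false n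
    with S m ℚₚ.≟ S n
  ... | no neq = m , n≤m , neq
  ... | yes Sm≡Sn = k , n≤k , λ Sk≡Sn →
    ℚₚ.<-asym {0ℚ} {3ℚ ℚ.+ 3ℚ} (ℚₚ.positive⁻¹ (3ℚ ℚ.+ 3ℚ))
      (subst (3ℚ ℚ.+ 3ℚ ℚ.<_) (trans
        (cong₂ (λ x y → x ℚ.+ ℚ.- y) Sm≡Sn Sk≡Sn) (ℚₚ.+-inverseʳ (S n)))
        (ℚₚ.+-mono-< 3<Sm 3<-Sk))

  open Selection q (direction ∘ suc) S refl (λ _ → refl) moves public

-- Real series

near-near : ∀ {x p q ε δ} → Near x p ε → Near x q δ → p ℚ.- ε ℚ.≤ q ℚ.+ δ
near-near g h using j , _ , g≤j , h≤j ← common-index 0 (index g) (index h) =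
  ℚₚ.≤-trans (near-lower g j g≤j) (near-upper h j h≤j)

∣x-y∣≤ : ∀ {x y c} → x ℚ.- y ℚ.≤ c → y ℚ.- x ℚ.≤ c → ℚ.∣ x ℚ.- y ∣ ℚ.≤ c
∣x-y∣≤ {x} {y} {c} x-y≤c y-x≤c = ∣x∣≤ {x ℚ.- y} {c} x-y≤c
  (subst (ℚ._≤ c) (solve 2 (λ x y → y :- x := :- (x :- y)) refl x y) y-x≤c)

near-∣-∣ : ∀ x y {p q ε δ} → Near x p ε → Near y q δ →
  Near ∣ x - y ∣ ℚ.∣ p ℚ.- q ∣ (ε ℚ.+ δ)
near-∣-∣ x y {p} {q} {ε} {δ} g h = near-∣∣ {x - y} {p ℚ.- q} {ε ℚ.+ δ}
  (near-+ {x} { - y} {p} {ℚ.- q} {ε} {δ} g (near-neg {y} {q} {δ} h))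

∣signed∣ : ∀ b x → ℚ.∣ signed b x ∣ ≡ ℚ.∣ x ∣
∣signed∣ true  x = refl
∣signed∣ false x = ℚₚ.∣-p∣≡∣p∣ x

double-positivePart : ∀ x → positivePart x ℚ.+ positivePart x ≡ ℚ.∣ x ∣ ℚ.+ x
double-positivePart x with 0ℚ ℚₚ.<? x
... | yes 0<x = cong (ℚ._+ x) (sym (ℚₚ.0≤p⇒∣p∣≡p (ℚₚ.<⇒≤ 0<x)))
... | no 0≮x = sym (trans (cong (ℚ._+ x) ∣x∣≡-x) (ℚₚ.+-inverseˡ x))
  where
  ∣x∣≡-x : ℚ.∣ x ∣ ≡ ℚ.- x
  ∣x∣≡-x = trans (sym (ℚₚ.∣-p∣≡∣p∣ x))
    (ℚₚ.0≤p⇒∣p∣≡p (ℚₚ.neg-antimono-≤ (ℚₚ.≮⇒≥ 0≮x)))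

double-signedVariation : ∀ q b n →
  signedVariation q b n ℚ.+ signedVariation q b n ≡
  sum (λ i → ℚ.∣ q i ∣) n ℚ.+ signed b (sum q n)
double-signedVariation q b zero = sym (trans (ℚₚ.+-identityˡ _) (signed-0 b))
double-signedVariation q b (suc n) = begin
  (F ℚ.+ p) ℚ.+ (F ℚ.+ p)
    ≡⟨ solve 2 (λ f p → (f :+ p) :+ (f :+ p) := (f :+ f) :+ (p :+ p)) refl F p ⟩
  (F ℚ.+ F) ℚ.+ (p ℚ.+ p)
    ≡⟨ cong₂ ℚ._+_ (double-signedVariation q b n) (double-positivePart (signed b (q n))) ⟩
  (τ ℚ.+ signed b σ) ℚ.+ (ℚ.∣ signed b (q n) ∣ ℚ.+ signed b (q n))
    ≡⟨ cong (λ d → (τ ℚ.+ signed b σ) ℚ.+ (d ℚ.+ signed b (q n))) (∣signed∣ b (q n)) ⟩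
  (τ ℚ.+ signed b σ) ℚ.+ (ℚ.∣ q n ∣ ℚ.+ signed b (q n))
    ≡⟨ solve 4 (λ t s d x → (t :+ s) :+ (d :+ x) := (t :+ d) :+ (s :+ x)) refl
         τ (signed b σ) ℚ.∣ q n ∣ (signed b (q n)) ⟩
  (τ ℚ.+ ℚ.∣ q n ∣) ℚ.+ (signed b σ ℚ.+ signed b (q n))
    ≡⟨ cong (λ s → (τ ℚ.+ ℚ.∣ q n ∣) ℚ.+ s) (signed-+ b σ (q n)) ⟨
  (τ ℚ.+ ℚ.∣ q n ∣) ℚ.+ signed b (σ ℚ.+ q n) ∎
  where
  open ≡-Reasoning
  F p τ σ : ℚ
  F = signedVariation q b n
  p = positivePart (signed b (q n))
  τ = sum (λ i → ℚ.∣ q i ∣) n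
  σ = sum q n

-- Twice the variation is `∑∣q∣` plus or minus `∑q`, an unbounded term and an eventually bounded
-- one. Passing `2c + B` with the former leaves more than `2c`.
signedVariation-unbounded : ∀ q →
  (∀ c → ∃[ n ] c ℚ.< sum (λ i → ℚ.∣ q i ∣) n) →
  (∃[ c ] ∃[ N ] ∀ n → N ℕ.≤ n → ℚ.∣ sum q n ∣ ℚ.≤ c) →
  ∀ b c n → ∃[ m ] n ℕ.≤ m × c ℚ.< signedVariation q b m
signedVariation-unbounded q ∑∣q∣-unbounded (B , N , ∣∑q∣≤B) b c n
  using k , large ← ∑∣q∣-unbounded ((c ℚ.+ c) ℚ.+ B)
  using m , k≤m , N≤m , n≤m ← common-index k N n = m , n≤m , ℚₚ.≰⇒> λ F≤c →
  ℚₚ.<-irrefl refl (ℚₚ.<-≤-trans 2c<F+F (ℚₚ.+-mono-≤ F≤c F≤c))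
  where
  τ : ℕ → ℚ
  τ = sum (λ i → ℚ.∣ q i ∣)
  F σ : ℚ
  F = signedVariation q b m
  σ = signed b (sum q m)
  -σ≤B : ℚ.- σ ℚ.≤ B
  -σ≤B = ℚₚ.≤-trans (-x≤∣x∣ σ)
    (subst (ℚ._≤ B) (sym (∣signed∣ b (sum q m))) (∣∑q∣≤B m N≤m))
  2c<F+F : c ℚ.+ c ℚ.< F ℚ.+ F
  2c<F+F = subst (c ℚ.+ c ℚ.<_) (sym (double-signedVariation q b m))
    (<-by (ℚₚ.+-mono-<-≤
        (ℚₚ.<-≤-trans large (sum-monotone (λ i → ℚₚ.0≤∣p∣ (q i)) k≤m)) -σ≤B)
      (solve 4 (λ c B t s → (t :+ s) :- c := (t :+ B) :- ((c :+ B) :+ :- s)) refl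
        (c ℚ.+ c) B (τ m) σ))

partialSum-∣∣ : ∀ a j n → seq (partialSum (∣_∣ ∘ a) n) j ≡ sum (λ i → ℚ.∣ seq (a i) j ∣) n
partialSum-∣∣ a j zero    = refl
partialSum-∣∣ a j (suc n) = cong (ℚ._+ ℚ.∣ seq (a n) j ∣) (partialSum-∣∣ a j n)

-- From `i ≤ e i` the error of the `i`-th chosen term is at most `halves i`, so the total bound 1
-- holds for every subseries.
near-subseries : ∀ {a q} → (∀ n → Near (a n) (q n) (halves n)) →
  ∀ {e} → StrictlyIncreasing e → ∀ k → Near (partialSum (a ∘ e) k) (sum (q ∘ e) k) 1ℚ
near-subseries {a} {q} h {e} e-inc k = near-weaken
  (ℚₚ.≤-trans (sum-mono-≤ (λ i → halves-antitone (strict-expanding e-inc i)) k) (sum-halves≤1 k))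
  (near-partialSum {a ∘ e} {q ∘ e} {halves ∘ e} (h ∘ e) k)

quarter : ∀ {ε} → 0ℚ ℚ.< ε → ∃[ η ] 0ℚ ℚ.< η × (η ℚ.+ η) ℚ.+ (η ℚ.+ η) ≡ ε
quarter {ε} 0<ε = ½ ℚ.* (½ ℚ.* ε) , 0<½* (0<½* 0<ε) ,
  trans (cong₂ ℚ._+_ (double-½ (½ ℚ.* ε)) (double-½ (½ ℚ.* ε))) (double-½ ε)
  where
  double-½ : ∀ x → ½ ℚ.* x ℚ.+ ½ ℚ.* x ≡ x
  double-½ x = trans (sym (ℚₚ.*-distribʳ-+ x ½ ½)) (ℚₚ.*-identityˡ x)

module Analysis (em : ExcludedMiddle 0ℓ) where

  open Classical em

  -- Monotonicity is assumed of the representing sequences: the partial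
  -- sums of ∣ a ∣ have it.
  module MonotoneConvergence (s : ℕ → ℝ)
    (monotone : ∀ {m n} → m ℕ.≤ n → ∀ j → seq (s m) j ℚ.≤ seq (s n) j)
    (r : ℕ → ℚ) (s-near-r : ∀ n → Near (s n) (r n) (halves n))
    (B : ℚ) (r≤B : ∀ n → r n ℚ.≤ B) where

    r-almost-monotone : ∀ {m n} → m ℕ.≤ n → r m ℚ.- halves m ℚ.≤ r n ℚ.+ halves n
    r-almost-monotone {m} {n} m≤n
      using j , _ , m≤j , n≤j ←
        common-index 0 (index (s-near-r m)) (index (s-near-r n)) =
      ℚₚ.≤-trans (near-lower (s-near-r m) j m≤j)
      (ℚₚ.≤-trans (monotone m≤n j) (near-upper (s-near-r n) j n≤j))

    -- An approximate maximum of the tail, in the place of a supremum.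
    Peak : ℚ → ℕ → Set
    Peak η N = ∀ n → N ℕ.≤ n → r n ℚ.≤ r N ℚ.+ η

    -- Without a peak, `r` could be raised by more than `η` again and again, and would exceed `B` by
    -- the Archimedean property.
    peak : ∀ {η} → 0ℚ ℚ.< η → ∀ M → ∃[ N ] M ℕ.≤ N × Peak η N
    peak {η} 0<η M with em {∃[ N ] M ℕ.≤ N × Peak η N}
    ... | yes found = found
    ... | no none
      using k , B-rM<kη ← archimedean (B ℚ.- r M) 0<η
      = let n , _ , ≤rn = climb k in ⊥-elim (ℚₚ.<-irrefl refl (ℚₚ.<-≤-trans
        (<-by B-rM<kη (solve 3 (λ B m x → (m :+ x) :- B := x :- (B :- m)) refl
          B (r M) (fromℕ k ℚ.* η)))
        (ℚₚ.≤-trans ≤rn (r≤B n))))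
      where
      step : ∀ N → M ℕ.≤ N → ∃[ n ] N ℕ.≤ n × r N ℚ.+ η ℚ.< r n
      step N M≤N
        using n , ¬≤ ← ¬∀⇒∃¬ (λ peak-N → none (N , M≤N , peak-N))
        using N≤n , rn≰ ← ¬∀⇒∃¬ ¬≤ = n , N≤n , ℚₚ.≰⇒> rn≰
      climb : ∀ k → ∃[ n ] M ℕ.≤ n × r M ℚ.+ fromℕ k ℚ.* η ℚ.≤ r n
      climb zero = M , ℕₚ.≤-refl , ℚₚ.≤-reflexive
        (solve 2 (λ x η → x :+ con 0ℚ :* η := x) refl (r M) η)
      climb (suc k)
        using n , M≤n , ≤rn ← climb k
        using n′ , n≤n′ , rn+η<rn′ ← step n M≤n = n′ , ℕₚ.≤-trans M≤n n≤n′ ,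
        ≤-by (ℚₚ.+-mono-≤ ≤rn (ℚₚ.<⇒≤ rn+η<rn′))
          (solve 5 (λ m k η n n′ → n′ :- (m :+ (con 1ℚ :+ k) :* η) :=
                     (n :+ n′) :- ((m :+ k :* η) :+ (n :+ η))) refl
            (r M) (fromℕ k) η (r n) (r n′))

    -- The peak gives `r m ≤ r N + η`, and almost-monotonicity puts `r N` at most
    -- `halves N + halves n` above `r n`. Seeking the peak beyond `M` makes these two errors at most
    -- `η` each.
    r-cauchy-bound : ∀ {η} → 0ℚ ℚ.< η → ∃[ N ] (∀ n → N ℕ.≤ n → halves n ℚ.≤ η) ×
      (∀ m n → N ℕ.≤ m → N ℕ.≤ n → r m ℚ.- r n ℚ.≤ (η ℚ.+ η) ℚ.+ η)
    r-cauchy-bound {η} 0<η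
      using M , halves-M<η ← halves→0 0<η
      using N , M≤N , peak-N ← peak 0<η M = N , small , λ m n N≤m N≤n →
      ≤-by (ℚₚ.+-mono-≤ (ℚₚ.+-mono-≤ (peak-N m N≤m) (r-almost-monotone N≤n))
          (ℚₚ.+-mono-≤ (small N ℕₚ.≤-refl) (small n N≤n)))
        (solve 6 (λ rm rn rN hN hn η → ((η :+ η) :+ η) :- (rm :- rn) :=
            (((rN :+ η) :+ (rn :+ hn)) :+ (η :+ η)) :- ((rm :+ (rN :- hN)) :+ (hN :+ hn)))
          refl (r m) (r n) (r N) (halves N) (halves n) η)
      where
      small : ∀ n → N ℕ.≤ n → halves n ℚ.≤ η
      small n N≤n = ℚₚ.≤-trans (halves-antitone (ℕₚ.≤-trans M≤N N≤n)) (ℚₚ.<⇒≤ halves-M<η)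

    r-cauchy : ∀ {η} → 0ℚ ℚ.< η → ∃[ N ] (∀ n → N ℕ.≤ n → halves n ℚ.≤ η) ×
      (∀ m n → N ℕ.≤ m → N ℕ.≤ n → ℚ.∣ r m ℚ.- r n ∣ ℚ.≤ (η ℚ.+ η) ℚ.+ η)
    r-cauchy {η} 0<η using N , small , close ← r-cauchy-bound 0<η = N , small , λ m n N≤m N≤n →
      ∣x-y∣≤ {r m} {r n} {(η ℚ.+ η) ℚ.+ η} (close m n N≤m N≤n) (close n m N≤n N≤m)

    limit : ℝ
    limit = mkℝ r cauchy-r
      where
      cauchy-r : ∀ ε → 0ℚ ℚ.< ε → ∃[ N ] ∀ m n → N ℕ.≤ m → N ℕ.≤ n →
        ℚ.∣ r m ℚ.- r n ∣ ℚ.< ε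
      cauchy-r ε 0<ε
        using η , 0<η , 4η≡ε ← quarter 0<ε
        using N , _ , close ← r-cauchy 0<η = N , λ m n N≤m N≤n →
          ℚₚ.≤-<-trans (close m n N≤m N≤n) (subst ((η ℚ.+ η) ℚ.+ η ℚ.<_) 4η≡ε
            (<-by 0<η (solve 1 (λ η → ((η :+ η) :+ (η :+ η)) :- ((η :+ η) :+ η) :=
              η :- con 0ℚ) refl η)))

    limit-near : ∀ {κ} → 0ℚ ℚ.< κ → ∃[ N ] ∀ n → N ℕ.≤ n → Near ∣ s n - limit ∣ 0ℚ κ
    limit-near {κ} 0<κ
      -- Three quarters bound the distance from `r n` to the limit, the fourth the distance from
      -- `s n` to `r n`.
      using η , 0<η , 4η≡κ ← quarter 0<κ
      using N , small , close ← r-cauchy 0<η =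
      let 3η : ℚ
          3η = (η ℚ.+ η) ℚ.+ η
          error : ℕ → ℚ
          error n = halves n ℚ.+ 3η
      in N , λ n N≤n → near-weaken {∣ s n - limit ∣} {0ℚ} {error n} {κ}
      (subst (error n ℚ.≤_) 4η≡κ
        (≤-by (small n N≤n) (solve 2 (λ h η →
          ((η :+ η) :+ (η :+ η)) :- (h :+ ((η :+ η) :+ η)) := η :- h) refl (halves n) η)))
      (subst (λ p → Near ∣ s n - limit ∣ ℚ.∣ p ∣ (error n)) (ℚₚ.+-inverseʳ (r n))
        (near-∣-∣ (s n) limit {r n} {r n} {halves n} {3η} (s-near-r n)
          (near N λ j N≤j → close j n N≤j N≤n)))

    converges : Converges s
    converges = limit , λ ε (δ , 0<δ , M , δ<ε) → convergesTo ε δ 0<δ M δ<ε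
      where
      convergesTo : ∀ ε δ → 0ℚ ℚ.< δ → ∀ M → (∀ n → M ℕ.≤ n → 0ℚ ℚ.+ δ ℚ.< seq ε n) →
        ∃[ N ] ∀ n → N ℕ.≤ n → ∣ s n - limit ∣ < ε
      -- Aiming at half of `δ` leaves the strict gap that `near⇒<` asks for.
      convergesTo ε δ 0<δ M δ<ε using N , close ← limit-near (0<½* 0<δ) = N , λ n N≤n →
        near⇒< ∣ s n - limit ∣ ε {0ℚ} {½ ℚ.* δ} {0ℚ ℚ.+ δ} (close n N≤n)
        (<-by (0<½* 0<δ) (solve 1 (λ δ → (con 0ℚ :+ δ) :- (con 0ℚ :+ con ½ :* δ) :=
          con ½ :* δ :- con 0ℚ) refl δ))
        (M , λ j M≤j → ℚₚ.<⇒≤ (δ<ε j M≤j))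

  -- Subseries of a conditionally convergent series.

  module _ (a : ℕ → ℝ) (cc : ConditionallyConvergent a) where

    q : ℕ → ℚ
    q n = proj₁ (rational-approximation (a n) (halves-pos n))

    a-near-q : ∀ n → Near (a n) (q n) (halves n)
    a-near-q n = proj₂ (rational-approximation (a n) (halves-pos n))

    ∑a-near-∑q : ∀ n → Near (partialSum a n) (sum q n) 1ℚ
    ∑a-near-∑q = near-subseries {a} {q} a-near-q {id} ℕₚ.n<1+n

    0<1 : 0ℚ ℚ.< 1ℚ
    0<1 = ℚₚ.positive⁻¹ 1ℚ

    0ℝ<1 : 0ℝ < const 1ℚ
    0ℝ<1 = near⇒< 0ℝ (const 1ℚ) {0ℚ} {0ℚ} {1ℚ} near-0ℝ 0<1 (0 , λ _ _ → ℚₚ.≤-refl)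

    ∣∑q∣-bounded : ∃[ c ] ∃[ N ] ∀ n → N ℕ.≤ n → ℚ.∣ sum q n ∣ ℚ.≤ c
    ∣∑q∣-bounded
      using l , conv ← proj₁ cc
      using N , close ← conv (const 1ℚ) 0ℝ<1
      using p , l-near-p ← rational-approximation l 0<1 =
      -- One unit each for the tolerance, the error of the partial sum and the error of `p`.
      3ℚ ℚ.+ ℚ.∣ p ∣ , N , λ n N≤n →
      ≤-by (ℚₚ.+-mono-≤ (∣x∣-∣y∣≤∣x-y∣ (sum q n) p)
          (ℚₚ.<⇒≤ (<⇒near ∣ partialSum a n - l ∣ (const 1ℚ) (close n N≤n)
            (near-∣-∣ (partialSum a n) l (∑a-near-∑q n) l-near-p) (near-const 1ℚ))))
        (solve 3 (λ s p d → (con 3ℚ :+ p) :- s :=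
            (d :+ (con 1ℚ :+ con 0ℚ)) :- ((s :- p) :+ (d :- (con 1ℚ :+ con 1ℚ))))
          refl ℚ.∣ sum q n ∣ ℚ.∣ p ∣ ℚ.∣ sum q n ℚ.- p ∣)

    -- Otherwise the partial sums of `∣ a ∣` are bounded and monotone, hence convergent. They are
    -- approximated afresh by `r`, whose errors vanish, while `∑∣q∣` is only known to be within 1.
    ∑∣q∣-unbounded : ∀ c → ∃[ n ] c ℚ.< sum (λ i → ℚ.∣ q i ∣) n
    ∑∣q∣-unbounded c with em {∃[ n ] c ℚ.< sum (λ i → ℚ.∣ q i ∣) n}
    ... | yes found = found
    ... | no none = ⊥-elim (proj₂ cc (MonotoneConvergence.converges s monotone r s-near-r
      ((c ℚ.+ 1ℚ) ℚ.+ 1ℚ) r≤))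
      where
      s : ℕ → ℝ
      s = partialSum (∣_∣ ∘ a)
      r : ℕ → ℚ
      r n = proj₁ (rational-approximation (s n) (halves-pos n))
      s-near-r : ∀ n → Near (s n) (r n) (halves n)
      s-near-r n = proj₂ (rational-approximation (s n) (halves-pos n))
      monotone : ∀ {m n} → m ℕ.≤ n → ∀ j → seq (s m) j ℚ.≤ seq (s n) j
      monotone {m} {n} m≤n j = subst₂ ℚ._≤_
        (sym (partialSum-∣∣ a j m)) (sym (partialSum-∣∣ a j n))
        (sum-monotone (λ i → ℚₚ.0≤∣p∣ (seq (a i) j)) m≤n)
      s-near-∑∣q∣ : ∀ n → Near (s n) (sum (λ i → ℚ.∣ q i ∣) n) 1ℚ
      s-near-∑∣q∣ = near-subseries {∣_∣ ∘ a} {λ i → ℚ.∣ q i ∣} (λ i → near-∣∣ (a-near-q i))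
        {id} ℕₚ.n<1+n
      r≤ : ∀ n → r n ℚ.≤ (c ℚ.+ 1ℚ) ℚ.+ 1ℚ
      r≤ n = ≤-by (ℚₚ.+-mono-≤ (near-near (s-near-r n) (s-near-∑∣q∣ n))
          (ℚₚ.+-mono-≤ (ℚₚ.≮⇒≥ (λ c< → none (n , c<)))
            (halves≤1 n)))
        (solve 4 (λ r h c t → ((c :+ con 1ℚ) :+ con 1ℚ) :- r :=
            ((t :+ con 1ℚ) :+ (c :+ con 1ℚ)) :- ((r :- h) :+ (t :+ h)))
          refl (r n) (halves n) c (sum (λ i → ℚ.∣ q i ∣) n))

    variation-unbounded : ∀ b c n → ∃[ m ] n ℕ.≤ m × c ℚ.< signedVariation q b m
    variation-unbounded = signedVariation-unbounded q ∑∣q∣-unbounded ∣∑q∣-bounded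

    divergent-subseries : ∃[ A ] Subseries DivergesToInfinity a A
    divergent-subseries = selected , enum , enumerates , inj₁ λ b → tends b
      where
      F : ℕ → ℚ
      F = signedVariation q true
      moves : ∀ n → ∃[ m ] n ℕ.≤ m × ¬ F m ≡ F n
      moves n using m , n≤m , Fn<Fm ← variation-unbounded true (F n) n =
        m , n≤m , λ Fm≡Fn → ℚₚ.<-irrefl (sym Fm≡Fn) Fn<Fm
      open Selection q (λ _ → true) F refl (λ _ → refl) moves
      tends : TendsTo+∞ (partialSum (a ∘ enum))
      tends b
        using β , b-near-β ← rational-approximation b 0<1
        -- One unit covers the error of `β`, the other that of the partial sum.
        using m , _ , large ← variation-unbounded true ((β ℚ.+ 1ℚ) ℚ.+ 1ℚ) 0 =
        m , λ k m≤k → near⇒< b (partialSum (a ∘ enum) k) b-near-β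
        (<-by (ℚₚ.<-≤-trans large (subst (F m ℚ.≤_) (sym (sum-enum k))
            (sum-monotone (λ i → 0≤positivePart (q i))
              (ℕₚ.≤-trans m≤k (strict-expanding enum-increasing k)))))
          (solve 2 (λ x s → (s :- con 1ℚ) :- x := s :- (x :+ con 1ℚ)) refl
            (β ℚ.+ 1ℚ) (sum (q ∘ enum) k)))
        (near⇒lower-bound (near-subseries {a} {q} a-near-q {enum} enum-increasing k))

    oscillating-subseries : ∃[ A ] Subseries Oscillates a A
    oscillating-subseries = selected , enum , enumerates , ¬conv , ¬+∞ , ¬-∞
      where
      open Oscillation q variation-unbounded
      s-near : ∀ k → Near (partialSum (a ∘ enum) k) (sum (q ∘ enum) k) 1ℚ
      s-near = near-subseries {a} {q} a-near-q {enum} enum-increasing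
      high : ∀ i → ∃[ k ] i ℕ.≤ k × 3ℚ ℚ.< sum (q ∘ enum) k
      high = attained {3ℚ ℚ.<_} (beyond-often true)
      low : ∀ i → ∃[ k ] i ℕ.≤ k × 3ℚ ℚ.< ℚ.- sum (q ∘ enum) k
      low = attained {λ x → 3ℚ ℚ.< ℚ.- x} (beyond-often false)
      ¬+∞ : ¬ TendsTo+∞ (partialSum (a ∘ enum))
      ¬+∞ tends
        using N , 0< ← tends 0ℝ
        -- A rational sum below -3 puts the real one below -2, though it should be positive from `N`
        -- on.
        using k , N≤k , 3<-x ← low N = ℚₚ.<-asym {0ℚ} {1ℚ ℚ.+ 1ℚ} (ℚₚ.positive⁻¹ (1ℚ ℚ.+ 1ℚ))
        (<-by (ℚₚ.+-mono-< 3<-x (<⇒near 0ℝ (partialSum (a ∘ enum) k) (0< k N≤k) near-0ℝ (s-near k)))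
          (solve 1 (λ x → con 0ℚ :- (con 1ℚ :+ con 1ℚ) :=
              (:- x :+ (x :+ con 1ℚ)) :- (con 3ℚ :+ (con 0ℚ :- con 0ℚ))) refl
            (sum (q ∘ enum) k)))
      ¬-∞ : ¬ TendsTo-∞ (partialSum (a ∘ enum))
      ¬-∞ tends
        using N , <0 ← tends 0ℝ
        using k , N≤k , 3<x ← high N = ℚₚ.<-asym {0ℚ} {1ℚ ℚ.+ 1ℚ} (ℚₚ.positive⁻¹ (1ℚ ℚ.+ 1ℚ))
        (<-by (ℚₚ.+-mono-< 3<x (<⇒near (partialSum (a ∘ enum) k) 0ℝ (<0 k N≤k) (s-near k) near-0ℝ))
          (solve 1 (λ x → con 0ℚ :- (con 1ℚ :+ con 1ℚ) :=
              (x :+ (con 0ℚ :+ con 0ℚ)) :- (con 3ℚ :+ (x :- con 1ℚ))) refl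
            (sum (q ∘ enum) k)))
      ¬conv : ¬ Converges (partialSum (a ∘ enum))
      ¬conv (l , conv)
        using N , close ← conv (const 1ℚ) 0ℝ<1
        using p , l-near-p ← rational-approximation l 0<1
        using k , N≤k , 3<x ← high N
        using i , N≤i , 3<-y ← low N = ℚₚ.<-irrefl {0ℚ} refl
        (<-by (ℚₚ.+-mono-< (ℚₚ.+-mono-< 3<x 3<-y)
            (ℚₚ.+-mono-< (ℚₚ.≤-<-trans (ℚₚ.+-monoˡ-≤ _ (x≤∣x∣ (x ℚ.- p))) (within k N≤k))
              (ℚₚ.≤-<-trans (ℚₚ.+-monoˡ-≤ _ (-x≤∣x∣ (y ℚ.- p))) (within i N≤i))))
          (solve 3 (λ x y p → con 0ℚ :- con 0ℚ :=
              ((x :+ :- y) :+ ((con 1ℚ :+ con 0ℚ) :+ (con 1ℚ :+ con 0ℚ))) :-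
              ((con 3ℚ :+ con 3ℚ) :+ (((x :- p) :- (con 1ℚ :+ con 1ℚ)) :+
                (:- (y :- p) :- (con 1ℚ :+ con 1ℚ))))) refl x y p))
        where
        x y : ℚ
        x = sum (q ∘ enum) k
        y = sum (q ∘ enum) i
        within : ∀ n → N ℕ.≤ n →
          ℚ.∣ sum (q ∘ enum) n ℚ.- p ∣ ℚ.- (1ℚ ℚ.+ 1ℚ) ℚ.< 1ℚ ℚ.+ 0ℚ
        within n N≤n = <⇒near ∣ partialSum (a ∘ enum) n - l ∣ (const 1ℚ) (close n N≤n)
          (near-∣-∣ (partialSum (a ∘ enum) n) l (s-near n) l-near-p) (near-const 1ℚ)

-- The bounds by the continuum.

module _ (em : ExcludedMiddle 0ℓ) (ext : Extensionality 0ℓ 0ℓ) where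

  -- The admissible families form the index type for `least`; the family of all subsets inhabits it.
  -- The first projection embeds the least one into `𝔠`, as membership is a proposition.
  least≤𝔠 : ∀ D → (∀ a → ConditionallyConvergent a → ∃[ A ] Subseries D a A) →
    ∃[ κ ] (IsLeastCardinality (Admissible D) κ × (κ ↣ 𝔠))
  least≤𝔠 D all-subseries
    using (𝒜 , adm) , 𝒜↣ ← Classical.LeastCardinal.least em ext
      {∃[ 𝒜 ] Admissible D 𝒜} (λ (𝒜 , _) → Elements 𝒜) ((λ _ → true) , λ a cc →
      let A , sub = all-subseries a cc in A , _ , sub) =
    Elements 𝒜 , ((𝒜 , adm , ↔-id _) , λ 𝒜′ adm′ → 𝒜↣ (𝒜′ , adm′)) ,
    mk↣ {to = proj₁} λ { {A , p} {.A , p′} refl → cong (A ,_) (Boolₚ.T-irrelevant p p′) }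

theorem5 : ExcludedMiddle 0ℓ → Extensionality 0ℓ 0ℓ →
    (∃[ κ ] (Is-ßᵢ κ × (κ ↣ 𝔠))) ×
    (∃[ κ ] (Is-ßₒ κ × (κ ↣ 𝔠))) ×
    (∃[ κ ] (Is-ß κ × (κ ↣ 𝔠)))
theorem5 em ext =
  least≤𝔠 em ext DivergesToInfinity divergent-subseries ,
  least≤𝔠 em ext Oscillates oscillating-subseries ,
  least≤𝔠 em ext Diverges λ a cc →
    let A , e , enumerates , ¬conv , _ = oscillating-subseries a cc in
    A , e , enumerates , ¬conv
  where open Analysis em
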